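{- There is an algorithm that, given an idempotent permutation $\pi\in IP(n,k)$ whose characteristic function $\varphi$ is defined implicitly, generates the corresponding idempotent map $\iota\in I(n,k)$ in-place of $\pi$ in $\mathcal{O}(kn)$ time using $4\log n$ bits.
   Context: $[n]=\{1,\ldots,n\}$. $I(n,k)$ is the set of idempotent maps $\iota:[n]\to[n]$ ($\iota(\iota(x))=\iota(x)$ for all $x$) with image of cardinality $k$. An idempotent permutation of degree $k$ ($1\le k\le n$) is a permutation $\pi$ of $[n]$ together with a distinguished set of indices $A=\{a_1<\cdots<a_k\}\subseteq[n]$ such that the values $c_i=\pi(a_i)$ satisfy $1=c_1<c_2<\cdots<c_k$. The values $c_i$ are called the fixed elements of $\pi$ (this does not mean $\pi(c_i)=c_i$), the others idle. Put $c_{k+1}=n+1$ and $[a_i]_\pi=\{x\in[n]:c_i\le\pi(x)<c_{i+1}\}$. $IP(n,k)$ denotes the set of idempotent permutations of degree $k$. The idempotent map corresponding to $\pi$ is the map $\iota\in I(n,k)$ with $\iota(x)=a_i$ for all $x\in[a_i]_\pi$, $i=1,\ldots,k$. The characteristic function $\varphi(x)=1$ if $x\in A$ and $0$ otherwise is "defined implicitly" when $\pi$ is stored with fixed elements negated: the entry at $x$ is $-\pi(x)$ if $x\in A$ and $\pi(x)$ otherwise. "In-place" means the array $D[1\ldots n]$ (entries integers in $[-n,n]$) initially holds this signed version of $\pi$ and finally holds $\iota$. Computation is on a unit-cost random access machine; "$4\log n$ bits" means that besides the array 4 auxiliary variables of $\log n$ bits each (indices or values of magnitude $O(n)$) are used.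 -}

module Defs where

open import Algebra.Definitions using (IdempotentFun)
open import Data.Bool using (Bool; if_then_else_)
open import Data.Fin as Fin using (Fin; toℕ; fromℕ<)
import Data.Fin.Properties as Fin
open import Data.Fin.Permutation using (Permutation′; _⟨$⟩ʳ_)
open import Data.Fin.Subset using (Subset) renaming (∣_∣ to card)
open import Data.Integer as ℤ using (ℤ; +_; -[1+_]; ∣_∣)
import Data.Integer.Properties as ℤ
open import Data.List using (List; head; drop)
open import Data.Maybe using (Maybe; just; nothing; map; _>>=_)
open import Data.Nat using (ℕ; zero; suc; _*_; _≤_; _<_; _<?_)
open import Data.Product using (_×_)
open import Data.Vec using (Vec; lookup; tabulate; replicate; _[_]≔_)
open import Data.Vec.Relation.Unary.All using (All)
open import Relation.Binary.PropositionalEquality using (_≡_)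
open import Relation.Nullary using (yes; no; does)

-- Fin n stands for [n] = {1,…,n}; val x is the number in {1,…,n} that x denotes.
val : ∀ {n} → Fin n → ℕ
val x = suc (toℕ x)

image : ∀ {n} → (Fin n → Fin n) → Subset n
image ι = tabulate λ y → does (Fin.any? λ x → ι x Fin.≟ y)

InI : ∀ n → ℕ → (Fin n → Fin n) → Set
InI n k ι = IdempotentFun _≡_ ι × card (image ι) ≡ k

-- The set A = {a₁ < ⋯ < aₖ} is given by its increasing enumeration a, so that
-- a and c are indexed from 0: a i is the element a_{i+1} of the usual numbering.
record IP (n k : ℕ) : Set where
  field
    1≤k          : 1 ≤ k
    perm         : Permutation′ n
    a            : Fin k → Fin n
    a-increasing : ∀ {i j} → i Fin.< j → a i Fin.< a j

  π : Fin n → Fin n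
  π x = perm ⟨$⟩ʳ x

  c : Fin k → Fin n
  c i = π (a i)

  field
    c-first      : ∀ i → toℕ i ≡ 0 → val (c i) ≡ 1
    c-increasing : ∀ {i j} → i Fin.< j → c i Fin.< c j

  -- The value of the (0-indexed) j-th fixed element, with n + 1 past the last one.
  threshold : ℕ → ℕ
  threshold j with j <? k
  ... | yes j<k = val (c (fromℕ< j<k))
  ... | no  _   = suc n

  Block : Fin k → Fin n → Set
  Block i x = val (c i) ≤ val (π x) × val (π x) < threshold (suc (toℕ i))

  φ : Fin n → Bool
  φ x = does (Fin.any? λ i → a i Fin.≟ x)

  signed : Vec ℤ n
  signed = tabulate λ x → if φ x then ℤ.- (+ val (π x)) else + val (π x)

  Corresponding : (Fin n → Fin n) → Set
  Corresponding ι = ∀ i x → Block i x → ι x ≡ a i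

mapArray : ∀ {n} → (Fin n → Fin n) → Vec ℤ n
mapArray ι = tabulate λ x → + val (ι x)

-- A unit-cost random access machine with w registers and an array D[1…n].
-- A program is a fixed finite list of instructions, independent of n;
-- len denotes the (read-only) length n of the array.

data Operand (w : ℕ) : Set where
  reg   : Fin w → Operand w
  const : ℤ → Operand w
  len   : Operand w

data Instr (w : ℕ) : Set where
  set add sub : Fin w → Operand w → Instr w       -- r := o,  r := r + o,  r := r - o
  load        : Fin w → Operand w → Instr w       -- r := D[o]
  store       : Operand w → Operand w → Instr w   -- D[o] := o′
  jump        : ℕ → Instr w
  jump<       : Operand w → Operand w → ℕ → Instr w   -- if o < o′ then goto ℓ
  halt        : Instr w

Program : ℕ → Set
Program w = List (Instr w)

record State (w n : ℕ) : Set where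
  constructor state
  field
    pc    : ℕ
    regs  : Vec ℤ w
    array : Vec ℤ n

open State public

fetch : ∀ {w n} → Program w → State w n → Maybe (Instr w)
fetch P s = head (drop (pc s) P)

index? : ∀ {n} → ℤ → Maybe (Fin n)
index? {n} (+ suc m) with m <? n
... | yes m<n = just (fromℕ< m<n)
... | no  _   = nothing
index? (+ zero) = nothing
index? -[1+ _ ] = nothing

module _ {w n : ℕ} where

  eval : Vec ℤ w → Operand w → ℤ
  eval R (reg r)   = lookup R r
  eval R (const z) = z
  eval R len       = + n

  -- nothing means that no step is possible: halt, or an array access out of range.
  exec : Instr w → State w n → Maybe (State w n)
  exec (set r o)      (state p R D) = just (state (suc p) (R [ r ]≔ eval R o) D)
  exec (add r o)      (state p R D) = just (state (suc p) (R [ r ]≔ (lookup R r ℤ.+ eval R o)) D)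
  exec (sub r o)      (state p R D) = just (state (suc p) (R [ r ]≔ (lookup R r ℤ.- eval R o)) D)
  exec (load r o)     (state p R D) = map (λ x → state (suc p) (R [ r ]≔ lookup D x) D) (index? (eval R o))
  exec (store o o′)   (state p R D) = map (λ x → state (suc p) R (D [ x ]≔ eval R o′)) (index? (eval R o))
  exec (jump ℓ)       (state p R D) = just (state ℓ R D)
  exec (jump< o o′ ℓ) (state p R D) = just (state (if does (eval R o ℤ.<? eval R o′) then ℓ else suc p) R D)
  exec halt           _             = nothing

  step : Program w → State w n → Maybe (State w n)
  step P s = fetch P s >>= λ i → exec i s

  -- Every register fits in log n + O(1) bits, and the array entries stay in [-n , n].
  Bounded : ℕ → State w n → Set
  Bounded B s = All (λ z → ∣ z ∣ ≤ B * n) (regs s) × All (λ z → ∣ z ∣ ≤ n) (array s)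

  -- Execution P B s t s′ : started in s, the program P halts in s′ after exactly t steps,
  -- and all states on the way, including s and s′, are bounded.
  data Execution (P : Program w) (B : ℕ) (s : State w n) : ℕ → State w n → Set where
    halted : Bounded B s → fetch P s ≡ just halt → Execution P B s 0 s
    next   : ∀ {s′ s″ t} → Bounded B s → step P s ≡ just s′ →
             Execution P B s′ t s″ → Execution P B s (suc t) s″

  initial : Vec ℤ n → State w n
  initial D = state 0 (replicate w (+ 0)) D

{-# OPTIONS --safe #-}
module Submission where

-- Write T j for the value of the fixed element number j + 1, and T k = n + 1. The program works
-- in two phases, each a sequence of rounds, and each round consists of two passes over the array,
-- from cell n down to cell 1. It has the four registers rank, lim, pos and tmp.
--
-- The first phase replaces the value of every entry by the number of its block, and keeps the
-- sign. Let rank = r, for r = 0, ..., k. A scan finds lim = T r: this is the smallest value above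
-- r among the negated entries, and as fixed elements increase with their position, it is the last
-- one met by a scan from the right (if there is none, then lim keeps the initial value n + 1). A
-- sweep then changes -lim into -(r + 1), and the positive entries in the interval from r to
-- lim - 1 into r. No marks are needed to tell the entries that have been replaced from the others:
-- a positive entry that has been replaced is less than r, and a negated one is at least -r, whereas
-- the other positive entries are at least T (r - 1) ≥ r if r ≥ 1, and the other negated ones at
-- most -T r < -r, because T increases strictly. For r = 0, no positive entry lies below lim = 1.
--
-- The second phase replaces the numbers by positions. Let rank = r, for r = k, ..., 1. A scan
-- finds the position lim of the only entry -r, and a sweep changes every r and -r into lim. Again
-- no marks are needed: the entries replaced before are positions of later fixed elements, and
-- the position of fixed element number i is at least i, hence greater than r.
--
-- Both phases together have 2 k + 1 rounds of O(n) steps, and k ≥ 1. No register ever exceeds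
-- 3 n in absolute value.
--
-- The invariants are stated cell by cell: Cell₁ r x z and Cell₂ r x z say that cell x may contain
-- z when the register rank is r in the first or second phase. That every pass keeps them is shown
-- by running the loop body symbolically, for each possible shape of the cell that is visited
-- (scanBody₁, sweepBody₁, scanBody₂, sweepBody₂), and rank₁ and unrank₂ compose the rounds.

open import Defs
open import Data.Bool using (true; if_then_else_)
open import Data.Fin as Fin using (Fin; zero; suc; toℕ; fromℕ<)
open import Data.Fin.Patterns using (0F; 1F; 2F; 3F)
import Data.Fin.Properties as Fin
open import Data.Fin.Subset using (Subset; _∈_; inside; outside) renaming (∣_∣ to card)
open import Data.Integer as ℤ using (ℤ; +_; -[1+_]; ∣_∣; _⊖_; -<+; +<+)
import Data.Integer.Properties as ℤ
open import Data.List using ([]; _∷_)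
open import Data.Maybe using (just; map; _>>=_)
open import Data.Nat using (ℕ; zero; suc; _+_; _*_; _≤_; _<_; _<?_; z≤n; s≤s; z<s)
open import Data.Nat.Properties
open import Data.Nat.Solver using (module +-*-Solver)
open import Data.Product using (Σ-syntax; ∃-syntax; _×_; _,_; proj₁; proj₂)
open import Data.Sum using (inj₁; inj₂)
open import Data.Vec using (Vec; []; _∷_; lookup; _[_]≔_; here; there)
open import Data.Vec.Properties
  using (lookup∘update; lookup∘update′; []≔-lookup; tabulate∘lookup; tabulate-cong;
         lookup∘tabulate; lookup⇒[]=; []=⇒lookup)
open import Data.Vec.Relation.Unary.All using (All; []; _∷_)
open import Data.Vec.Relation.Unary.All.Properties using (lookup⁻)
open import Function using (_∘_; _$_; case_of_)
open import Relation.Binary.Definitions using (tri<; tri≈; tri>)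
open import Relation.Binary.PropositionalEquality
open import Relation.Nullary using (¬_; does; yes; no; contradiction)
open import Relation.Nullary.Decidable using (dec-true; dec-false)

-- Integers and finite ordinals

⊖-pos : ∀ {m n} → n < m → + 0 ℤ.< m ⊖ n
⊖-pos {m} {n} n<m = subst (ℤ._< m ⊖ n) (ℤ.n⊖n≡0 n) (ℤ.⊖-monoˡ-< n n<m)

⊖-nonneg : ∀ {m n} → n ≤ m → + 0 ℤ.≤ m ⊖ n
⊖-nonneg {m} {n} n≤m = subst (ℤ._≤ m ⊖ n) (ℤ.n⊖n≡0 n) (ℤ.⊖-monoˡ-≤ n n≤m)

⊖-neg : ∀ {m n} → m < n → m ⊖ n ℤ.< + 0
⊖-neg {m} {n} m<n = subst (m ⊖ n ℤ.<_) (ℤ.n⊖n≡0 n) (ℤ.⊖-monoˡ-< n m<n)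

-1-n≡-[1+n] : ∀ n → -[1+ 0 ] ℤ.- + n ≡ -[1+ n ]
-1-n≡-[1+n] zero    = refl
-1-n≡-[1+n] (suc n) = refl

n-[n⊖m]≡m : ∀ n m → + n ℤ.- (n ⊖ m) ≡ + m
n-[n⊖m]≡m n m = begin
  + n ℤ.- (n ⊖ m)  ≡⟨ cong (λ z → + n ℤ.+ z) (ℤ.⊖-swap m n) ⟨
  + n ℤ.+ (m ⊖ n)  ≡⟨ ℤ.distribʳ-⊖-+-pos n m n ⟩
  n + m ⊖ n        ≡⟨ cong (n + m ⊖_) (+-identityʳ n) ⟨
  n + m ⊖ (n + 0)  ≡⟨ ℤ.+-cancelˡ-⊖ n m 0 ⟩
  + m              ∎
  where open ≡-Reasoning

-- A strictly increasing sequence of numbers is at least the identity.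
i≤f[i] : ∀ {k n} (f : Fin k → Fin n) → (∀ {i j} → i Fin.< j → f i Fin.< f j) →
         ∀ i → toℕ i ≤ toℕ (f i)
i≤f[i] {k} f f-increasing i =
  subst (λ j → toℕ i ≤ toℕ (f j)) (Fin.fromℕ<-toℕ i (Fin.toℕ<n i)) (go (toℕ i) (Fin.toℕ<n i))
  where
  go : ∀ m (m<k : m < k) → m ≤ toℕ (f (fromℕ< m<k))
  go zero    _   = z≤n
  go (suc m) m<k = ≤-<-trans (go m (<-trans (n<1+n m) m<k))
    (f-increasing (subst₂ _<_ (sym (Fin.toℕ-fromℕ< _)) (sym (Fin.toℕ-fromℕ< _)) (n<1+n m)))

-- Cardinality of an image

-- The increasing enumeration of a subset.
enum : ∀ {n} (p : Subset n) → Fin (card p) → Fin n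
enum (outside ∷ p) i       = suc (enum p i)
enum (inside  ∷ p) zero    = zero
enum (inside  ∷ p) (suc i) = suc (enum p i)

enum-injective : ∀ {n} (p : Subset n) {i j} → enum p i ≡ enum p j → i ≡ j
enum-injective (outside ∷ p)                   e = enum-injective p (Fin.suc-injective e)
enum-injective (inside  ∷ p) {zero}  {zero}  e = refl
enum-injective (inside  ∷ p) {suc i} {suc j} e = cong suc (enum-injective p (Fin.suc-injective e))

enum-∈ : ∀ {n} (p : Subset n) i → enum p i ∈ p
enum-∈ (outside ∷ p) i       = there (enum-∈ p i)
enum-∈ (inside  ∷ p) zero    = here
enum-∈ (inside  ∷ p) (suc i) = there (enum-∈ p i)

enum-surjective : ∀ {n} (p : Subset n) {x} → x ∈ p → ∃[ i ] enum p i ≡ x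
enum-surjective (inside  ∷ p) here = zero , refl
enum-surjective (outside ∷ p) (there x∈p) with i , e ← enum-surjective p x∈p = i , cong suc e
enum-surjective (inside  ∷ p) (there x∈p) with i , e ← enum-surjective p x∈p = suc i , cong suc e

-- A set that an injective family on Fin k enumerates has k elements.
card-enumerated : ∀ {n k} (p : Subset n) (f : Fin k → Fin n) →
  (∀ {i j} → f i ≡ f j → i ≡ j) → (∀ i → f i ∈ p) → (∀ {x} → x ∈ p → ∃[ i ] f i ≡ x) →
  card p ≡ k
card-enumerated p f f-injective f∈p f-surjective = ≤-antisym
  (Fin.injective⇒≤ {f = proj₁ ∘ to} λ {i} {j} e →
    enum-injective p (trans (sym (proj₂ (to i))) (trans (cong f e) (proj₂ (to j)))))
  (Fin.injective⇒≤ {f = proj₁ ∘ from} λ {i} {j} e →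
    f-injective (trans (sym (proj₂ (from i))) (trans (cong (enum p) e) (proj₂ (from j)))))
  where
  to : ∀ i → ∃[ j ] f j ≡ enum p i
  to i = f-surjective (enum-∈ p i)

  from : ∀ j → ∃[ i ] enum p i ≡ f j
  from j = enum-surjective p (f∈p j)

-- The program and its execution

rank lim pos tmp : Fin 4
rank = 0F
lim  = 1F
pos  = 2F
tmp  = 3F

-- The number at the end of a line is the address of its instruction. The first phase extends
-- from 0 to 28, with the scan at 2 to 9 and the sweep at 10 to 24. The second phase extends from
-- 29 to 48, with the scan at 29 to 35 and the sweep at 36 to 46.
program : Program 4
program =
    set lim len                                  --  0
  ∷ add lim (const (+ 1))                        --  1
  ∷ set pos len                                  --  2
  ∷ load tmp (reg pos)                           --  3
  ∷ add tmp (reg rank)                           --  4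
  ∷ jump< (const -[1+ 0 ]) (reg tmp) 8           --  5
  ∷ set lim (reg rank)                           --  6
  ∷ sub lim (reg tmp)                            --  7
  ∷ sub pos (const (+ 1))                        --  8
  ∷ jump< (const (+ 0)) (reg pos) 3              --  9
  ∷ set pos len                                  -- 10
  ∷ load tmp (reg pos)                           -- 11
  ∷ jump< (reg tmp) (reg rank) 17                -- 12
  ∷ jump< (reg tmp) (reg lim) 15                 -- 13
  ∷ jump 23                                      -- 14
  ∷ store (reg pos) (reg rank)                   -- 15
  ∷ jump 23                                      -- 16
  ∷ add tmp (reg lim)                            -- 17
  ∷ jump< (reg tmp) (const (+ 0)) 23             -- 18
  ∷ jump< (const (+ 0)) (reg tmp) 23             -- 19
  ∷ set tmp (const -[1+ 0 ])                     -- 20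
  ∷ sub tmp (reg rank)                           -- 21
  ∷ store (reg pos) (reg tmp)                    -- 22
  ∷ sub pos (const (+ 1))                        -- 23
  ∷ jump< (const (+ 0)) (reg pos) 11             -- 24
  ∷ add rank (const (+ 1))                       -- 25
  ∷ jump< len (reg lim) 28                       -- 26
  ∷ jump 0                                       -- 27
  ∷ sub rank (const (+ 1))                       -- 28
  ∷ set pos len                                  -- 29
  ∷ load tmp (reg pos)                           -- 30
  ∷ add tmp (reg rank)                           -- 31
  ∷ jump< (const (+ 0)) (reg tmp) 34             -- 32
  ∷ set lim (reg pos)                            -- 33
  ∷ sub pos (const (+ 1))                        -- 34
  ∷ jump< (const (+ 0)) (reg pos) 30             -- 35
  ∷ set pos len                                  -- 36
  ∷ load tmp (reg pos)                           -- 37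
  ∷ jump< (reg rank) (reg tmp) 45                -- 38
  ∷ jump< (reg tmp) (reg rank) 42                -- 39
  ∷ store (reg pos) (reg lim)                    -- 40
  ∷ jump 45                                      -- 41
  ∷ add tmp (reg rank)                           -- 42
  ∷ jump< (const (+ 0)) (reg tmp) 45             -- 43
  ∷ store (reg pos) (reg lim)                    -- 44
  ∷ sub pos (const (+ 1))                        -- 45
  ∷ jump< (const (+ 0)) (reg pos) 37             -- 46
  ∷ sub rank (const (+ 1))                       -- 47
  ∷ jump< (const (+ 0)) (reg rank) 29            -- 48
  ∷ halt                                         -- 49
  ∷ []

index?-val : ∀ {n} (x : Fin n) → index? (+ val x) ≡ just x
index?-val {n} x with toℕ x <? n
... | yes x<n = cong just (Fin.fromℕ<-toℕ x x<n)
... | no  x≮n = contradiction (Fin.toℕ<n x) x≮n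

module Machine (n : ℕ) where

  State′ : Set
  State′ = State 4 n

  -- The state with program counter p and with the contents r, c, y, t of rank, lim, pos, tmp.
  st : ℕ → ℤ → ℤ → ℤ → ℤ → Vec ℤ n → State′
  st p r c y t D = state p (r ∷ c ∷ y ∷ t ∷ []) D

  -- The bounds that Bounded 3 imposes on a register and on the array.
  Small : ℤ → Set
  Small z = ∣ z ∣ ≤ 3 * n

  Entries : Vec ℤ n → Set
  Entries D = All (λ z → ∣ z ∣ ≤ n) D

  ok : ∀ {r c y t D} → Small r → Small c → Small y → Small t → Entries D →
       All Small (r ∷ c ∷ y ∷ t ∷ []) × Entries D
  ok sr sc sy st sD = sr ∷ sc ∷ sy ∷ st ∷ [] , sD

  -- Reach Q K s: starting from s, the program comes to a state that satisfies Q within K steps,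
  -- and every state before it is bounded. K is only an upper bound for the number of steps, so
  -- that the branches of a loop body need not take equally long.
  data Reach (Q : State′ → Set) : ℕ → State′ → Set where
    now  : ∀ {K s} → Q s → Reach Q K s
    then : ∀ {K s s′} → Bounded 3 s → step program s ≡ just s′ → Reach Q K s′ → Reach Q (suc K) s

  weaken : ∀ {Q K L s} → K ≤ L → Reach Q K s → Reach Q L s
  weaken _         (now q)      = now q
  weaken (s≤s K≤L) (then b e r) = then b e (weaken K≤L r)

  bind : ∀ {Q R K L s} → Reach Q K s → (∀ {s} → Q s → Reach R L s) → Reach R (K + L) s
  bind {K = K} {L} (now q)      f = weaken (m≤n+m L K) (f q)
  bind             (then b e r) f = then b e (bind r f)

  -- Where a loop with entry h and exit e continues when its index has value j.
  target : ℕ → ℕ → ℕ → ℕ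
  target h e zero    = e
  target h e (suc j) = h

  target-head : ∀ {h e j} → 1 ≤ j → target h e j ≡ h
  target-head (s≤s _) = refl

  -- The rule for a loop over all cells, from cell n down to cell 1. I j is the invariant when the
  -- cells with numbers above j have been visited.
  loop : (I : ℕ → State′ → Set) {K : ℕ} →
         (∀ x {s} → I (val x) s → Reach (I (toℕ x)) K s) →
         ∀ {s} → I n s → Reach (I 0) (n * K) s
  loop I {K} body = go n ≤-refl
    where
    go : ∀ m → m ≤ n → ∀ {s} → I m s → Reach (I 0) (m * K) s
    go zero    _   q = now q
    go (suc m) m<n q = bind (body′ q) (go m (<⇒≤ m<n))
      where
      body′ : ∀ {s} → I (suc m) s → Reach (I m) K s
      body′ q = subst (λ j → Reach (I j) K _) (Fin.toℕ-fromℕ< m<n)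
        (body (fromℕ< m<n) (subst (λ j → I (suc j) _) (sym (Fin.toℕ-fromℕ< m<n)) q))

  -- Symbolic execution of the instructions whose effect depends on the contents of the registers.
  module _ {Q : State′ → Set} {K : ℕ} {s : State′} (b : Bounded 3 s) where

    jumps : ∀ {o o′ ℓ} → fetch program s ≡ just (jump< o o′ ℓ) →
            eval {n = n} (regs s) o ℤ.< eval {n = n} (regs s) o′ →
            Reach Q K (state ℓ (regs s) (array s)) → Reach Q (suc K) s
    jumps {o} {o′} {ℓ} f lt = then b (trans (cong (_>>= λ i → exec i s) f)
      (cong (λ d → just (state (if d then ℓ else suc (pc s)) (regs s) (array s)))
        (dec-true (eval (regs s) o ℤ.<? eval (regs s) o′) lt)))

    falls : ∀ {o o′ ℓ} → fetch program s ≡ just (jump< o o′ ℓ) →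
            ¬ (eval {n = n} (regs s) o ℤ.< eval {n = n} (regs s) o′) →
            Reach Q K (state (suc (pc s)) (regs s) (array s)) → Reach Q (suc K) s
    falls {o} {o′} {ℓ} f nlt = then b (trans (cong (_>>= λ i → exec i s) f)
      (cong (λ d → just (state (if d then ℓ else suc (pc s)) (regs s) (array s)))
        (dec-false (eval (regs s) o ℤ.<? eval (regs s) o′) nlt)))

    -- The test at the end of a loop, when the index is j.
    repeats : ∀ {o h} j → fetch program s ≡ just (jump< (const (+ 0)) o h) →
              eval {n = n} (regs s) o ≡ + j →
              Reach Q K (state (target h (suc (pc s)) j) (regs s) (array s)) → Reach Q (suc K) s
    repeats zero    f e = falls f (subst (λ z → ¬ (+ 0 ℤ.< z)) (sym e) (ℤ.<-irrefl refl))
    repeats (suc j) f e = jumps f (subst (+ 0 ℤ.<_) (sym e) (+<+ z<s))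

    loads : ∀ {r o} x → fetch program s ≡ just (load r o) → eval {n = n} (regs s) o ≡ + val x →
            Reach Q K (state (suc (pc s)) (regs s [ r ]≔ lookup (array s) x) (array s)) →
            Reach Q (suc K) s
    loads x f e = then b (trans (cong (_>>= λ i → exec i s) f)
      (cong (map _) (trans (cong index? e) (index?-val x))))

    stores : ∀ {o o′} x → fetch program s ≡ just (store o o′) → eval {n = n} (regs s) o ≡ + val x →
             Reach Q K (state (suc (pc s)) (regs s) (array s [ x ]≔ eval {n = n} (regs s) o′)) →
             Reach Q (suc K) s
    stores x f e = then b (trans (cong (_>>= λ i → exec i s) f)
      (cong (map _) (trans (cong index? e) (index?-val x))))

  -- The array D in the middle of a sweep that turns Old into New: a cell is related to its
  -- content by Old if its number is at most j, and by New otherwise.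
  record Swept (Old New : Fin n → ℤ → Set) (j : ℕ) (D : Vec ℤ n) : Set where
    constructor mkSwept
    field
      old : ∀ x → toℕ x < j → Old x (lookup D x)
      new : ∀ x → j ≤ toℕ x → New x (lookup D x)

  open Swept

  sweep-store : ∀ {Old New D x v} → Swept Old New (val x) D → New x v →
                Swept Old New (toℕ x) (D [ x ]≔ v)
  sweep-store {Old} {New} {D} {x} {v} swept newv = mkSwept old′ new′
    where
    other : ∀ {y} → y ≢ x → lookup (D [ x ]≔ v) y ≡ lookup D y
    other y≢x = lookup∘update′ y≢x D v
    old′ : ∀ y → toℕ y < toℕ x → Old y (lookup (D [ x ]≔ v) y)
    old′ y y<x = subst (Old y) (sym (other λ { refl → <-irrefl refl y<x }))
      (old swept y (m<n⇒m<1+n y<x))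
    new′ : ∀ y → toℕ x ≤ toℕ y → New y (lookup (D [ x ]≔ v) y)
    new′ y x≤y with y Fin.≟ x
    ... | yes refl = subst (New x) (sym (lookup∘update x D v)) newv
    ... | no y≢x   = subst (New y) (sym (other y≢x))
      (new swept y (≤∧≢⇒< x≤y (y≢x ∘ sym ∘ Fin.toℕ-injective)))

  sweep-keep : ∀ {Old New D x} → Swept Old New (val x) D → New x (lookup D x) →
               Swept Old New (toℕ x) D
  sweep-keep {Old} {New} {D} {x} swept newv =
    subst (Swept Old New (toℕ x)) ([]≔-lookup D x) (sweep-store swept newv)

  swept-entries : ∀ {Old New j D} → (∀ x {z} → Old x z → ∣ z ∣ ≤ n) →
                  (∀ x {z} → New x z → ∣ z ∣ ≤ n) → Swept Old New j D → Entries D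
  swept-entries {j = j} old-bound new-bound swept = lookup⁻ λ x → case toℕ x <? j of λ where
    (yes x<j) → old-bound x (old swept x x<j)
    (no  x≮j) → new-bound x (new swept x (≮⇒≥ x≮j))

  -- The invariant of a sweep with entry h and exit e that leaves r in rank and c in lim.
  data Sweep (h e : ℕ) (r c : ℤ) (Old New : Fin n → ℤ → Set) (j : ℕ) : State′ → Set where
    sweep : ∀ {t D} → Small t → Swept Old New j D →
            Sweep h e r c Old New j (st (target h e j) r c (+ j) t D)

-- Blocks of an idempotent permutation

module Algorithm {n k : ℕ} (ip : IP n k) where
  open IP ip
  open Machine n
  open Swept

  -- T j is the value of the fixed element number j + 1 for j < k, and n + 1 for j = k.
  T : ℕ → ℕ
  T = threshold

  a-injective : ∀ {i j} → a i ≡ a j → i ≡ j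
  a-injective {i} {j} e with Fin.<-cmp i j
  ... | tri< i<j _ _ = contradiction (cong toℕ e) (<⇒≢ (a-increasing i<j))
  ... | tri≈ _ i≡j _ = i≡j
  ... | tri> _ _ j<i = contradiction (cong toℕ (sym e)) (<⇒≢ (a-increasing j<i))

  T-< : ∀ {j} (j<k : j < k) → T j ≡ val (c (fromℕ< j<k))
  T-< {j} j<k with j <? k
  ... | yes _  = refl
  ... | no j≮k = contradiction j<k j≮k

  T-Fin : ∀ i → T (toℕ i) ≡ val (c i)
  T-Fin i = trans (T-< (Fin.toℕ<n i)) (cong (val ∘ c) (Fin.fromℕ<-toℕ i (Fin.toℕ<n i)))

  T-last : T k ≡ suc n
  T-last with k <? k
  ... | yes k<k = contradiction k<k (<-irrefl refl)
  ... | no _    = refl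

  T-first : T 0 ≡ 1
  T-first = trans (T-< 1≤k) (c-first _ (Fin.toℕ-fromℕ< 1≤k))

  T-step : ∀ {j} → j < k → T j < T (suc j)
  T-step {j} j<k with suc j <? k
  ... | yes 1+j<k = subst (_< val (c (fromℕ< 1+j<k))) (sym (T-< j<k))
    (s≤s (c-increasing (subst₂ _<_ (sym (Fin.toℕ-fromℕ< j<k)) (sym (Fin.toℕ-fromℕ< 1+j<k)) (n<1+n j))))
  ... | no _      = subst (_< suc n) (sym (T-< j<k)) (s≤s (Fin.toℕ<n _))

  T-mono : ∀ {i j} → i ≤ j → j ≤ k → T i ≤ T j
  T-mono {i} {zero}  z≤n j≤k = ≤-refl
  T-mono {i} {suc j} i≤j j≤k with m≤n⇒m<n∨m≡n i≤j
  ... | inj₁ i<j  = ≤-trans (T-mono (≤-pred i<j) (<⇒≤ j≤k)) (<⇒≤ (T-step j≤k))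
  ... | inj₂ refl = ≤-refl

  T-mono-< : ∀ {i j} → i < j → j ≤ k → T i < T j
  T-mono-< i<j j≤k = <-≤-trans (T-step (<-≤-trans i<j j≤k)) (T-mono i<j j≤k)

  j<T[j] : ∀ {j} → j ≤ k → j < T j
  j<T[j] {zero}  _   = ≤-reflexive (sym T-first)
  j<T[j] {suc j} j<k = ≤-<-trans (j<T[j] (<⇒≤ j<k)) (T-step j<k)

  k≤n : k ≤ n
  k≤n = ≤-pred (subst (k <_) T-last (j<T[j] ≤-refl))

  Block-unique : ∀ {i j x} → Block i x → Block j x → i ≡ j
  Block-unique {i} {j} {x} (ci≤ , <ci′) (cj≤ , <cj′) with Fin.<-cmp i j
  ... | tri≈ _ i≡j _ = i≡j
  ... | tri< i<j _ _ = contradiction (<-≤-trans <ci′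
          (≤-trans (T-mono i<j (<⇒≤ (Fin.toℕ<n j))) (subst (_≤ val (π x)) (sym (T-Fin j)) cj≤)))
          (<-irrefl refl)
  ... | tri> _ _ j<i = contradiction (<-≤-trans <cj′
          (≤-trans (T-mono j<i (<⇒≤ (Fin.toℕ<n i))) (subst (_≤ val (π x)) (sym (T-Fin i)) ci≤)))
          (<-irrefl refl)

  Block-a : ∀ i → Block i (a i)
  Block-a i = ≤-refl , subst (_< T (val i)) (T-Fin i) (T-step (Fin.toℕ<n i))

  Block-exists : ∀ x → ∃[ i ] Block i x
  Block-exists x = go k ≤-refl (subst (val (π x) <_) (sym T-last) (s≤s (Fin.toℕ<n (π x))))
    where
    -- Downward search for the last threshold that is not above π x.
    go : ∀ j → j ≤ k → val (π x) < T j → ∃[ i ] Block i x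
    go zero    _   v<T = contradiction (subst (val (π x) <_) T-first v<T) λ { (s≤s ()) }
    go (suc j) j<k v<T with val (π x) <? T j
    ... | yes v<T′ = go j (<⇒≤ j<k) v<T′
    ... | no  v≮T′ = fromℕ< j<k ,
      subst (_≤ val (π x)) (T-< j<k) (≮⇒≥ v≮T′) ,
      subst (λ m → val (π x) < T (suc m)) (sym (Fin.toℕ-fromℕ< j<k)) v<T

  block : Fin n → Fin k
  block x = proj₁ (Block-exists x)

  -- The idempotent map that corresponds to the idempotent permutation.
  ι : Fin n → Fin n
  ι x = a (block x)

  corresponding : Corresponding ι
  corresponding i x b = cong a (Block-unique (proj₂ (Block-exists x)) b)

  -- The image of ι is A, as ι fixes every a i.
  ι-inI : InI n k ι
  ι-inI = (λ x → corresponding (block x) (ι x) (Block-a (block x))) ,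
          card-enumerated (image ι) a a-injective
            (λ i → lookup⇒[]= (a i) (image ι) (trans (lookup∘tabulate _ (a i))
              (dec-true (Fin.any? _) (a i , corresponding i (a i) (Block-a i)))))
            λ {y} y∈ → preimage y (trans (sym (lookup∘tabulate _ y)) ([]=⇒lookup y∈))
    where
    preimage : ∀ y → does (Fin.any? λ x → ι x Fin.≟ y) ≡ true → ∃[ i ] a i ≡ y
    preimage y e with Fin.any? (λ x → ι x Fin.≟ y)
    ... | yes (x , ιx≡y) = block x , ιx≡y
    ... | no _ with () ← e

  -- Bounds on the registers

  n≥1 : 1 ≤ n
  n≥1 = ≤-trans 1≤k k≤n

  1+n≤2n : suc n ≤ n + n
  1+n≤2n = +-monoˡ-≤ n n≥1

  small : ∀ {z} → ∣ z ∣ ≤ n → Small z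
  small z≤ = ≤-trans z≤ (m≤m+n n _)

  small₂ : ∀ {z} → ∣ z ∣ ≤ n + n → Small z
  small₂ z≤ = ≤-trans z≤ (≤-trans (m≤n+m (n + n) n)
    (≤-reflexive (cong (λ m → n + (n + m)) (sym (+-identityʳ n)))))

  small₁ : ∀ {z} → ∣ z ∣ ≤ suc n → Small z
  small₁ {z} z≤ = small₂ {z} (≤-trans z≤ 1+n≤2n)

  small+ : ∀ {u v} → ∣ u ∣ ≤ n → ∣ v ∣ ≤ suc n → Small (u ℤ.+ v)
  small+ {u} {v} u≤ v≤ = ≤-trans (ℤ.∣i+j∣≤∣i∣+∣j∣ u v)
    (≤-trans (+-mono-≤ u≤ (≤-trans v≤ 1+n≤2n)) (≤-reflexive (cong (λ m → n + (n + m)) (sym (+-identityʳ n)))))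

  sn : Small (+ n)
  sn = small {+ n} ≤-refl

  spos : ∀ (x : Fin n) → Small (+ val x)
  spos x = small {+ val x} (Fin.toℕ<n x)

  spos′ : ∀ (x : Fin n) → Small (+ toℕ x)
  spos′ x = small {+ toℕ x} (<⇒≤ (Fin.toℕ<n x))

  T≤1+n : ∀ {r} → r ≤ k → T r ≤ suc n
  T≤1+n r≤k = subst (T _ ≤_) T-last (T-mono r≤k ≤-refl)

  -- x is not in A, that is, its value is an idle element.
  Idle : Fin n → Set
  Idle x = ∀ i → a i ≢ x

  -- First phase: from values to numbers of blocks

  -- The possible contents z of cell x at the beginning of the round with rank = r. Blocks are
  -- numbered from 1, so that block i has the number val i. The fixed elements numbered 1 to r have
  -- been replaced, but only blocks 1 to r - 1 of idle elements: the value T (r - 1) of fixed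
  -- element r, the lower end of block r, is known before the upper end T r.
  data Cell₁ (r : ℕ) (x : Fin n) : ℤ → Set where
    fixedDone : ∀ i → a i ≡ x → toℕ i < r → Cell₁ r x -[1+ toℕ i ]
    fixedTodo : ∀ i → a i ≡ x → r ≤ toℕ i → Cell₁ r x -[1+ toℕ (c i) ]
    idleDone  : ∀ i → Idle x → Block i x → val i < r → Cell₁ r x (+ val i)
    idleTodo  : ∀ i → Idle x → Block i x → r ≤ val i → Cell₁ r x (+ val (π x))

  bound₁ : ∀ {r x z} → Cell₁ r x z → ∣ z ∣ ≤ n
  bound₁ (fixedDone i _ _)  = ≤-trans (Fin.toℕ<n i) k≤n
  bound₁ (fixedTodo i _ _)  = Fin.toℕ<n (c i)
  bound₁ (idleDone i _ _ _) = ≤-trans (Fin.toℕ<n i) k≤n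
  bound₁ (idleTodo i _ _ _) = Fin.toℕ<n _

  entries₁ : ∀ {r j D} → Swept (Cell₁ r) (Cell₁ (suc r)) j D → Entries D
  entries₁ = swept-entries (λ _ → bound₁) (λ _ → bound₁)

  module _ {r : ℕ} (r≤k : r ≤ k) where

    sr : Small (+ r)
    sr = small {+ r} (≤-trans r≤k k≤n)

    sT : Small (+ T r)
    sT = small₁ {+ T r} (T≤1+n r≤k)

    -- The invariant of the scan: lim is correct once the cell of fixed element r + 1 has been
    -- visited. If r = k, then there is no such element, and lim = n + 1 is correct throughout.
    data Scan₁ (D : Vec ℤ n) (j : ℕ) : State′ → Set where
      scan : ∀ {c′ t} → Small c′ → Small t →
             ((∀ i → toℕ i ≡ r → j ≤ toℕ (a i)) → c′ ≡ + T r) →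
             Scan₁ D j (st (target 3 10 j) (+ r) c′ (+ j) t D)

    module _ {D : Vec ℤ n} (cells : ∀ x → Cell₁ r x (lookup D x)) where

      sD : Entries D
      sD = lookup⁻ λ x → bound₁ (cells x)

      scanBody₁ : ∀ (x : Fin n) {s} → Scan₁ D (val x) s → Reach (Scan₁ D (toℕ x)) 7 s
      scanBody₁ x (scan {c′} sc st′ c-ok) =
        loads (ok sr sc (spos x) st′ sD) x refl refl $
        then (ok sr sc (spos x) (small {lookup D x} (bound₁ (cells x))) sD) refl $
        go (cells x)
        where
        Goal : ℤ → Set
        Goal z = Reach (Scan₁ D (toℕ x)) 5 (st 5 (+ r) c′ (+ val x) (z ℤ.+ + r) D)

        sz : ∀ {z} → Cell₁ r x z → Small (z ℤ.+ + r)
        sz {z} cell = small+ {z} {+ r} (bound₁ cell) (≤-trans r≤k (m≤n⇒m≤1+n k≤n))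

        -- The contents z is not below -r, and lim stays as it is.
        keep : ∀ {z} → Cell₁ r x z → + 0 ℤ.≤ z ℤ.+ + r →
               (∀ i → toℕ i ≡ r → a i ≢ x) → Goal z
        keep cell nonneg x≢a =
          jumps (ok sr sc (spos x) (sz cell) sD) refl (ℤ.<-≤-trans -<+ nonneg) $
          then (ok sr sc (spos x) (sz cell) sD) refl $
          repeats (ok sr sc (spos′ x) (sz cell) sD) (toℕ x) refl refl $
          now (scan sc (sz cell) λ prem → c-ok λ i i≡r →
            ≤∧≢⇒< (prem i i≡r) (x≢a i i≡r ∘ sym ∘ Fin.toℕ-injective))

        go : ∀ {z} → Cell₁ r x z → Goal z
        go cell@(fixedDone i ai≡x i<r) =
          keep cell (⊖-nonneg i<r)
            λ j j≡r aj≡x → <⇒≢ i<r (trans (cong toℕ (a-injective (trans ai≡x (sym aj≡x)))) j≡r)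
        go cell@(idleDone _ idle _ _) = keep cell (ℤ.+≤+ z≤n) λ j _ → idle j
        go cell@(idleTodo _ idle _ _) = keep cell (ℤ.+≤+ z≤n) λ j _ → idle j
        go {z} cell@(fixedTodo i ai≡x r≤i) =
          falls (ok sr sc (spos x) (sz cell) sD) refl (λ -1<t → ℤ.<⇒≱ (⊖-neg r<ci) (ℤ.i<j⇒suc[i]≤j -1<t)) $
          then (ok sr sc (spos x) (sz cell) sD) refl $
          then (ok sr sr (spos x) (sz cell) sD)
            (cong (λ c″ → just (st 8 (+ r) c″ (+ val x) (z ℤ.+ + r) D)) (n-[n⊖m]≡m r (val (c i)))) $
          then (ok sr sci (spos x) (sz cell) sD) refl $
          repeats (ok sr sci (spos′ x) (sz cell) sD) (toℕ x) refl refl $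
          now (scan sci (sz cell) λ prem → cong +_ (trans (sym (T-Fin i)) (cong T (i≡r prem))))
          where
          sci : Small (+ val (c i))
          sci = small {+ val (c i)} (Fin.toℕ<n (c i))
          r<ci : r < val (c i)
          r<ci = s≤s (≤-trans r≤i (i≤f[i] c c-increasing i))
          -- If i > r, then fixed element r + 1 lies to the left of x and has not been visited yet.
          i≡r : (∀ j → toℕ j ≡ r → toℕ x ≤ toℕ (a j)) → toℕ i ≡ r
          i≡r prem with m≤n⇒m<n∨m≡n r≤i
          ... | inj₂ r≡i = sym r≡i
          ... | inj₁ r<i = contradiction
            (subst (_≤ toℕ (a j)) (sym (cong toℕ ai≡x)) (prem j toj))
            (<⇒≱ (a-increasing (subst (_< toℕ i) (sym toj) r<i)))
            where
            r<k : r < k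
            r<k = <-trans r<i (Fin.toℕ<n i)
            j : Fin k
            j = fromℕ< r<k
            toj : toℕ j ≡ r
            toj = Fin.toℕ-fromℕ< r<k

      -- The state after the scan.
      data Limit₁ : State′ → Set where
        limit : ∀ {t} → Small t → Limit₁ (st 10 (+ r) (+ T r) (+ 0) t D)

      scan₁ : ∀ {c y t} → Small c → Small y → Small t →
              Reach Limit₁ (3 + (n * 7 + 0)) (st 0 (+ r) c y t D)
      scan₁ {c = c₀} {y} {t} sc sy st′ =
        then (ok sr sc sy st′ sD) refl $
        then (ok sr sn sy st′ sD)
          (cong (λ c′ → just (st 2 (+ r) (+ c′) y t D)) (+-comm n 1)) $
        then (ok sr s1+n sy st′ sD) refl $
        bind (loop (Scan₁ D) scanBody₁ start) finish
        where
        s1+n : Small (+ suc n)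
        s1+n = small₁ {+ suc n} ≤-refl
        start : Scan₁ D n (st 3 (+ r) (+ suc n) (+ n) t D)
        start = subst (λ p → Scan₁ D n (st p (+ r) (+ suc n) (+ n) t D)) (target-head n≥1)
          (scan s1+n st′ λ prem → cong +_ (trans (sym T-last) (cong T (sym (r≡k prem)))))
          where
          r≡k : (∀ i → toℕ i ≡ r → n ≤ toℕ (a i)) → r ≡ k
          r≡k prem with m≤n⇒m<n∨m≡n r≤k
          ... | inj₂ e   = e
          ... | inj₁ r<k =
            contradiction (prem (fromℕ< r<k) (Fin.toℕ-fromℕ< r<k)) (<⇒≱ (Fin.toℕ<n _))
        finish : ∀ {s} → Scan₁ D 0 s → Reach Limit₁ 0 s
        finish (scan _ st″ c-ok) with refl ← c-ok (λ _ _ → z≤n) = now (limit st″)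

    Sweep₁ : ℕ → State′ → Set
    Sweep₁ = Sweep 11 25 (+ r) (+ T r) (Cell₁ r) (Cell₁ (suc r))

    sweepBody₁ : ∀ (x : Fin n) {s} → Sweep₁ (val x) s → Reach (Sweep₁ (toℕ x)) 10 s
    sweepBody₁ x (sweep {t} {D} st′ swept) =
      loads (ok sr sT (spos x) st′ sE) x refl refl $
      branch (old swept x ≤-refl) refl
      where
      sE : Entries D
      sE = entries₁ swept

      -- The end of the loop body, where all branches meet.
      continue : ∀ {t D K} → Small t → Swept (Cell₁ r) (Cell₁ (suc r)) (toℕ x) D →
                 Reach (Sweep₁ (toℕ x)) (2 + K) (st 23 (+ r) (+ T r) (+ val x) t D)
      continue sz swept′ =
        then (ok sr sT (spos x) sz sD′) refl $
        repeats (ok sr sT (spos′ x) sz sD′) (toℕ x) refl refl $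
        now (sweep sz swept′)
        where sD′ = entries₁ swept′

      r<T : r < T r
      r<T = j<T[j] r≤k

      sz : ∀ {z} → Cell₁ r x z → Small z
      sz {z} cell = small {z} (bound₁ cell)

      sz+ : ∀ {z} → Cell₁ r x z → Small (z ℤ.+ + T r)
      sz+ {z} cell = small+ {z} {+ T r} (bound₁ cell) (T≤1+n r≤k)

      kept : ∀ {z} → lookup D x ≡ z → Cell₁ (suc r) x z → Swept (Cell₁ r) (Cell₁ (suc r)) (toℕ x) D
      kept e new = sweep-keep swept (subst (Cell₁ (suc r) x) (sym e) new)

      branch : ∀ {z} → Cell₁ r x z → lookup D x ≡ z →
        Reach (Sweep₁ (toℕ x)) 9 (st 12 (+ r) (+ T r) (+ val x) z D)
      branch cell@(fixedDone i ai≡x i<r) e =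
        jumps (ok sr sT (spos x) (sz cell) sE) refl -<+ $
        then (ok sr sT (spos x) (sz cell) sE) refl $
        falls (ok sr sT (spos x) (sz+ cell) sE) refl (ℤ.<-asym t>0) $
        jumps (ok sr sT (spos x) (sz+ cell) sE) refl t>0 $
        continue (sz+ cell) (kept e (fixedDone i ai≡x (m<n⇒m<1+n i<r)))
        where
        t>0 : + 0 ℤ.< T r ⊖ val i
        t>0 = ⊖-pos (≤-<-trans i<r r<T)
      branch cell@(idleDone i idle b i<r) e =
        jumps (ok sr sT (spos x) (sz cell) sE) refl (+<+ i<r) $
        then (ok sr sT (spos x) (sz cell) sE) refl $
        falls (ok sr sT (spos x) (sz+ cell) sE) refl (ℤ.<-asym t>0) $
        jumps (ok sr sT (spos x) (sz+ cell) sE) refl t>0 $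
        continue (sz+ cell) (kept e (idleDone i idle b (m<n⇒m<1+n i<r)))
        where
        t>0 : + 0 ℤ.< + (val i + T r)
        t>0 = +<+ z<s
      branch cell@(idleTodo i idle b@(ci≤v , v<c′) r≤i) e =
        falls (ok sr sT (spos x) (sz cell) sE) refl (λ { (+<+ v<r) → ≤⇒≯ r≤v v<r }) $
        case m≤n⇒m<n∨m≡n r≤i of λ where
          -- x belongs to block r, which is replaced now.
          (inj₂ refl) →
            jumps (ok sr sT (spos x) (sz cell) sE) refl (+<+ v<c′) $
            stores (ok sr sT (spos x) (sz cell) sE) x refl refl $
            then (ok sr sT (spos x) (sz cell) (entries₁ (stored (idleDone i idle b ≤-refl)))) refl $
            continue (sz cell) (stored (idleDone i idle b ≤-refl))
          -- x belongs to a later block, and its value is at least T r.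
          (inj₁ r<i) →
            falls (ok sr sT (spos x) (sz cell) sE) refl
              (λ { (+<+ v<T) → ≤⇒≯ (≤-trans (T-mono (≤-pred r<i) (<⇒≤ (Fin.toℕ<n i)))
                (subst (_≤ val (π x)) (sym (T-Fin i)) ci≤v)) v<T }) $
            then (ok sr sT (spos x) (sz cell) sE) refl $
            continue (sz cell) (kept e (idleTodo i idle b r<i))
        where
        stored : ∀ {z} → Cell₁ (suc r) x z → Swept (Cell₁ r) (Cell₁ (suc r)) (toℕ x) (D [ x ]≔ z)
        stored = sweep-store swept
        r≤v : r ≤ val (π x)
        r≤v = ≤-trans r≤i (≤-trans (s≤s (i≤f[i] c c-increasing i)) ci≤v)
      branch cell@(fixedTodo i ai≡x r≤i) e =
        jumps (ok sr sT (spos x) (sz cell) sE) refl -<+ $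
        then (ok sr sT (spos x) (sz cell) sE) refl $
        case m≤n⇒m<n∨m≡n r≤i of λ where
          (inj₂ refl) →
            let t≡0 = trans (cong (_⊖ val (c i)) (T-Fin i)) (ℤ.n⊖n≡0 (val (c i))) in
            falls (ok sr sT (spos x) (sz+ cell) sE) refl (ℤ.<-irrefl t≡0) $
            falls (ok sr sT (spos x) (sz+ cell) sE) refl (ℤ.<-irrefl (sym t≡0)) $
            then (ok sr sT (spos x) (sz+ cell) sE) refl $
            then (ok sr sT (spos x) s-1 sE)
              (cong (λ t → just (st 22 (+ r) (+ T r) (+ val x) t D)) (-1-n≡-[1+n] r)) $
            stores (ok sr sT (spos x) (s-1-r i) sE) x refl refl $
            continue (s-1-r i) (sweep-store swept (fixedDone i ai≡x ≤-refl))
          (inj₁ r<i) →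
            let T<ci = subst (T r <_) (T-Fin i) (T-mono-< r<i (<⇒≤ (Fin.toℕ<n i))) in
            jumps (ok sr sT (spos x) (sz+ cell) sE) refl (⊖-neg T<ci) $
            continue (sz+ cell) (kept e (fixedTodo i ai≡x r<i))
        where
        s-1 : Small -[1+ 0 ]
        s-1 = small { -[1+ 0 ] } n≥1
        s-1-r : ∀ i → Small -[1+ toℕ i ]
        s-1-r i = small { -[1+ toℕ i ] } (≤-trans (Fin.toℕ<n i) k≤n)

    -- The state after the sweep, where rank is still to be increased.
    data Ranked₁ : State′ → Set where
      ranked : ∀ {t D} → Small t → (∀ x → Cell₁ (suc r) x (lookup D x)) →
               Ranked₁ (st 25 (+ r) (+ T r) (+ 0) t D)

    sweep₁ : ∀ {t D} → Small t → (∀ x → Cell₁ r x (lookup D x)) →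
             Reach Ranked₁ (1 + (n * 10 + 0)) (st 10 (+ r) (+ T r) (+ 0) t D)
    sweep₁ {t} {D} st′ cells =
      then (ok sr sT z≤n st′ (lookup⁻ λ x → bound₁ (cells x))) refl $
      bind (loop Sweep₁ sweepBody₁ start) λ where
        (sweep st″ swept) → now (ranked st″ λ x → new swept x z≤n)
      where
      start : Sweep₁ n (st 11 (+ r) (+ T r) (+ n) t D)
      start = subst (λ p → Sweep₁ n (st p (+ r) (+ T r) (+ n) t D)) (target-head n≥1)
        (sweep st′ (mkSwept (λ x _ → cells x) λ x n≤x → contradiction (Fin.toℕ<n x) (≤⇒≯ n≤x)))

  -- The state at the beginning of a round of the first phase.
  data Head₁ (r : ℕ) : State′ → Set where
    head₁ : ∀ {c y t D} → Small c → Small y → Small t → (∀ x → Cell₁ r x (lookup D x)) →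
            Head₁ r (st 0 (+ r) c y t D)

  -- The possible contents z of cell x at the beginning of a round of the second phase with
  -- rank = r, where blocks 1 to r still have their numbers and the later ones have been replaced
  -- by positions. For r = 0 the array is the result.
  data Cell₂ (r : ℕ) (x : Fin n) : ℤ → Set where
    fixedRank : ∀ i → a i ≡ x → toℕ i < r → Cell₂ r x -[1+ toℕ i ]
    idleRank  : ∀ i → Idle x → Block i x → toℕ i < r → Cell₂ r x (+ val i)
    final     : ∀ i → Block i x → r ≤ toℕ i → Cell₂ r x (+ val (a i))

  -- The state at the beginning of such a round, or at the end of the program if r = 0.
  data Head₂ (r : ℕ) : State′ → Set where
    head₂ : ∀ {c y t D} → Small c → Small y → Small t → (∀ x → Cell₂ r x (lookup D x)) →
            Head₂ r (st (target 29 49 r) (+ r) c y t D)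

  Cell₁⇒Cell₂ : ∀ {x z} → Cell₁ (suc k) x z → Cell₂ k x z
  Cell₁⇒Cell₂ (fixedDone i ai≡x _)     = fixedRank i ai≡x (Fin.toℕ<n i)
  Cell₁⇒Cell₂ (fixedTodo i _ k<i)      = contradiction (Fin.toℕ<n i) (<-asym k<i)
  Cell₁⇒Cell₂ (idleDone i idle b _)    = idleRank i idle b (Fin.toℕ<n i)
  Cell₁⇒Cell₂ (idleTodo i _ _ k<i)     = contradiction (Fin.toℕ<n i) (≤⇒≯ (≤-pred k<i))

  -- Two passes of p and q steps per cell and at most 7 more steps cost at most 24 n steps.
  round-cost : ∀ p q {m} → m ≤ 7 → p + q ≡ 17 → m + (n * p + n * q) ≤ 24 * n
  round-cost p q {m} m≤7 p+q≡17 = begin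
    m + (n * p + n * q) ≡⟨ cong (λ l → m + l) (sym (*-distribˡ-+ n p q)) ⟩
    m + n * (p + q)     ≡⟨ cong (λ l → m + n * l) p+q≡17 ⟩
    m + n * 17          ≤⟨ +-monoˡ-≤ (n * 17) (≤-trans m≤7 (*-monoˡ-≤ 7 n≥1)) ⟩
    n * 7 + n * 17      ≡⟨ sym (*-distribˡ-+ n 7 17) ⟩
    n * 24              ≡⟨ *-comm n 24 ⟩
    24 * n              ∎
    where open ≤-Reasoning

  -- The d + 1 last rounds of the first phase.
  rank₁ : ∀ d {r s} → r + d ≡ k → Head₁ r s → Reach (Head₂ k) (suc d * (24 * n)) s
  rank₁ d {r} r+d≡k (head₁ sc sy st′ cells) =
    bind (weaken cost (bind (scan₁ r≤k cells sc sy st′) λ where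
      (limit st″) → bind (sweep₁ r≤k st″ cells) (count d r+d≡k))) (continue d r+d≡k)
    where
    r≤k : r ≤ k
    r≤k = subst (r ≤_) r+d≡k (m≤m+n r d)

    -- What follows the round: the second phase if d = 0, and the next round otherwise.
    Next : ℕ → State′ → Set
    Next zero    = Head₂ k
    Next (suc d) = Head₁ (suc r)

    continue : ∀ d → r + d ≡ k → ∀ {s} → Next d s → Reach (Head₂ k) (d * (24 * n)) s
    continue zero    _ h = now h
    continue (suc d) e h = rank₁ d (trans (sym (+-suc r d)) e) h

    cost : 3 + (n * 7 + 0) + (1 + (n * 10 + 0) + 3) ≤ 24 * n
    cost = ≤-trans (≤-reflexive (solve 1 (λ n →
        con 3 :+ (n :* con 7 :+ con 0) :+ (con 1 :+ (n :* con 10 :+ con 0) :+ con 3) :=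
        con 7 :+ (n :* con 7 :+ n :* con 10)) refl n))
      (round-cost 7 10 ≤-refl refl)
      where open +-*-Solver

    -- The instructions between the sweep and the next round.
    count : ∀ d → r + d ≡ k → ∀ {s} → Ranked₁ r≤k s → Reach (Next d) 3 s
    count d e (ranked {t} {D} st″ cells′) =
      then (ok (sr r≤k) (sT r≤k) z≤n st″ sE) (cong (λ r′ → just (st 26 (+ r′) (+ T r) (+ 0) t D)) (+-comm r 1)) $
      branch d e
      where
      sE : Entries D
      sE = lookup⁻ λ x → bound₁ (cells′ x)
      s1+r : Small (+ suc r)
      s1+r = small₁ {+ suc r} (s≤s (≤-trans r≤k k≤n))
      branch : ∀ d → r + d ≡ k → Reach (Next d) 2 (st 26 (+ suc r) (+ T r) (+ 0) t D)
      branch zero e with refl ← trans (sym (+-identityʳ r)) e =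
        jumps (ok s1+r (sT r≤k) z≤n st″ sE) refl (+<+ (≤-reflexive (sym T-last))) $
        then (ok s1+r (sT r≤k) z≤n st″ sE) refl $
        now (subst (λ p → Head₂ k (st p (+ k) (+ T k) (+ 0) t D)) (target-head 1≤k)
          (head₂ (sT r≤k) z≤n st″ λ x → Cell₁⇒Cell₂ (cells′ x)))
      branch (suc d) e =
        falls (ok s1+r (sT r≤k) z≤n st″ sE) refl (λ { (+<+ n<T) → ≤⇒≯ n<T T<1+n }) $
        then (ok s1+r (sT r≤k) z≤n st″ sE) refl $
        now (head₁ (sT r≤k) z≤n st″ cells′)
        where
        T<1+n : T r < suc n
        T<1+n = subst (T r <_) T-last (T-mono-< (subst (r <_) e (m<m+n r z<s)) ≤-refl)

  -- Second phase: from numbers of blocks to positions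

  bound₂ : ∀ {r x z} → Cell₂ r x z → ∣ z ∣ ≤ n
  bound₂ (fixedRank i _ _)  = ≤-trans (Fin.toℕ<n i) k≤n
  bound₂ (idleRank i _ _ _) = ≤-trans (Fin.toℕ<n i) k≤n
  bound₂ (final i _ _)      = Fin.toℕ<n (a i)

  entries₂ : ∀ {r j D} → Swept (Cell₂ (suc r)) (Cell₂ r) j D → Entries D
  entries₂ = swept-entries (λ _ → bound₂) (λ _ → bound₂)

  -- The round with rank = val m, which replaces the number of block m by the position a m.
  module _ (m : Fin k) where
    r : ℕ
    r = val m

    r≤n : r ≤ n
    r≤n = ≤-trans (Fin.toℕ<n m) k≤n

    sr₂ : Small (+ r)
    sr₂ = small {+ r} r≤n

    sz₂ : ∀ {x z} → Cell₂ r x z → Small z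
    sz₂ {z = z} cell = small {z} (bound₂ cell)

    sz₂+ : ∀ {x z} → Cell₂ r x z → Small (z ℤ.+ + r)
    sz₂+ {z = z} cell = small+ {z} {+ r} (bound₂ cell) (m≤n⇒m≤1+n r≤n)

    -- The invariant of the scan: lim is correct once cell a m has been visited.
    data Scan₂ (D : Vec ℤ n) (j : ℕ) : State′ → Set where
      scan : ∀ {c′ t} → Small c′ → Small t → (j ≤ toℕ (a m) → c′ ≡ + val (a m)) →
             Scan₂ D j (st (target 30 36 j) (+ r) c′ (+ j) t D)

    module _ {D : Vec ℤ n} (cells : ∀ x → Cell₂ r x (lookup D x)) where

      sD₂ : Entries D
      sD₂ = lookup⁻ λ x → bound₂ (cells x)

      scanBody₂ : ∀ (x : Fin n) {s} → Scan₂ D (val x) s → Reach (Scan₂ D (toℕ x)) 6 s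
      scanBody₂ x (scan {c′} sc st′ c-ok) =
        loads (ok sr₂ sc (spos x) st′ sD₂) x refl refl $
        then (ok sr₂ sc (spos x) (sz₂ (cells x)) sD₂) refl $
        go (cells x)
        where
        Goal : ℤ → Set
        Goal z = Reach (Scan₂ D (toℕ x)) 4 (st 32 (+ r) c′ (+ val x) (z ℤ.+ + r) D)

        -- The contents z is above -r, and lim stays as it is.
        keep : ∀ {z} → Cell₂ r x z → + 0 ℤ.< z ℤ.+ + r → a m ≢ x → Goal z
        keep {z} cell pos′ x≢a =
          jumps (ok sr₂ sc (spos x) (sz₂+ cell) sD₂) refl pos′ $
          then (ok sr₂ sc (spos x) (sz₂+ cell) sD₂) refl $
          repeats (ok sr₂ sc (spos′ x) (sz₂+ cell) sD₂) (toℕ x) refl refl $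
          now (scan sc (sz₂+ cell) λ x≤a → c-ok (≤∧≢⇒< x≤a (x≢a ∘ sym ∘ Fin.toℕ-injective)))

        go : ∀ {z} → Cell₂ r x z → Goal z
        go cell@(fixedRank i ai≡x i<r) with m≤n⇒m<n∨m≡n (≤-pred i<r)
        ... | inj₁ i<m =
          keep cell (⊖-pos (s≤s i<m))
            λ am≡x → <⇒≢ i<m (cong toℕ (a-injective (trans ai≡x (sym am≡x))))
        ... | inj₂ i≡m with refl ← Fin.toℕ-injective i≡m =
          falls (ok sr₂ sc (spos x) (sz₂+ cell) sD₂) refl (ℤ.<-irrefl (sym (ℤ.n⊖n≡0 (val i)))) $
          then (ok sr₂ sc (spos x) (sz₂+ cell) sD₂) refl $
          then (ok sr₂ (spos x) (spos x) (sz₂+ cell) sD₂) refl $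
          repeats (ok sr₂ (spos x) (spos′ x) (sz₂+ cell) sD₂) (toℕ x) refl refl $
          now (scan (spos x) (sz₂+ cell) λ _ → cong (+_ ∘ val) (sym ai≡x))
        go cell@(idleRank i idle _ _) = keep cell (+<+ z<s) (idle m)
        go cell@(final i b r≤i)       = keep cell (+<+ z<s)
          λ { refl → <⇒≢ r≤i (cong toℕ (Block-unique (Block-a m) b)) }

      -- The state after the scan.
      data Position₂ : State′ → Set where
        position : ∀ {t} → Small t → Position₂ (st 36 (+ r) (+ val (a m)) (+ 0) t D)

      scan₂ : ∀ {c y t} → Small c → Small y → Small t →
              Reach Position₂ (1 + (n * 6 + 0)) (st 29 (+ r) c y t D)
      scan₂ {c₀} {y} {t} sc sy st′ =
        then (ok sr₂ sc sy st′ sD₂) refl $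
        bind (loop (Scan₂ D) scanBody₂ start) finish
        where
        start : Scan₂ D n (st 30 (+ r) c₀ (+ n) t D)
        start = subst (λ p → Scan₂ D n (st p (+ r) c₀ (+ n) t D)) (target-head n≥1)
          (scan sc st′ λ n≤a → contradiction (Fin.toℕ<n (a m)) (≤⇒≯ n≤a))
        finish : ∀ {s} → Scan₂ D 0 s → Reach Position₂ 0 s
        finish (scan _ st″ c-ok) with refl ← c-ok z≤n = now (position st″)

    p : ℤ
    p = + val (a m)

    sp : Small p
    sp = spos (a m)

    Sweep₂ : ℕ → State′ → Set
    Sweep₂ = Sweep 37 47 (+ r) p (Cell₂ r) (Cell₂ (toℕ m))

    sweepBody₂ : ∀ (x : Fin n) {s} → Sweep₂ (val x) s → Reach (Sweep₂ (toℕ x)) 8 s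
    sweepBody₂ x (sweep {t} {D} st′ swept) =
      loads (ok sr₂ sp (spos x) st′ sE) x refl refl $
      branch (old swept x ≤-refl) refl
      where
      sE : Entries D
      sE = entries₂ swept

      continue : ∀ {t D K} → Small t → Swept (Cell₂ r) (Cell₂ (toℕ m)) (toℕ x) D →
                 Reach (Sweep₂ (toℕ x)) (2 + K) (st 45 (+ r) p (+ val x) t D)
      continue sz swept′ =
        then (ok sr₂ sp (spos x) sz (entries₂ swept′)) refl $
        repeats (ok sr₂ sp (spos′ x) sz (entries₂ swept′)) (toℕ x) refl refl $
        now (sweep sz swept′)

      kept : ∀ {z} → lookup D x ≡ z → Cell₂ (toℕ m) x z → Swept (Cell₂ r) (Cell₂ (toℕ m)) (toℕ x) D
      kept e newc = sweep-keep swept (subst (Cell₂ (toℕ m) x) (sym e) newc)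

      branch : ∀ {z} → Cell₂ r x z → lookup D x ≡ z →
               Reach (Sweep₂ (toℕ x)) 7 (st 38 (+ r) p (+ val x) z D)
      -- The entry is already a position, and val (a i) ≥ val i > r.
      branch cell@(final i b r≤i) e =
        jumps (ok sr₂ sp (spos x) (sz₂ cell) sE) refl (+<+ (s≤s (≤-trans r≤i (i≤f[i] a a-increasing i)))) $
        continue (sz₂ cell) (kept e (final i b (<⇒≤ r≤i)))
      branch cell@(idleRank i idle b i<r) e =
        falls (ok sr₂ sp (spos x) (sz₂ cell) sE) refl (λ { (+<+ r<i) → ≤⇒≯ i<r r<i }) $
        case m≤n⇒m<n∨m≡n (≤-pred i<r) of λ where
          (inj₁ i<m) →
            jumps (ok sr₂ sp (spos x) (sz₂ cell) sE) refl (+<+ (s≤s i<m)) $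
            then (ok sr₂ sp (spos x) (sz₂ cell) sE) refl $
            jumps (ok sr₂ sp (spos x) (sz₂+ cell) sE) refl (+<+ z<s) $
            continue (sz₂+ cell) (kept e (idleRank i idle b i<m))
          (inj₂ i≡m) → case Fin.toℕ-injective i≡m of λ where
            refl →
              let swept′ = sweep-store swept (final i b ≤-refl) in
              falls (ok sr₂ sp (spos x) (sz₂ cell) sE) refl (ℤ.<-irrefl refl) $
              stores (ok sr₂ sp (spos x) (sz₂ cell) sE) x refl refl $
              then (ok sr₂ sp (spos x) (sz₂ cell) (entries₂ swept′)) refl $
              continue (sz₂ cell) swept′
      branch cell@(fixedRank i ai≡x i<r) e =
        falls (ok sr₂ sp (spos x) (sz₂ cell) sE) refl (λ ()) $
        jumps (ok sr₂ sp (spos x) (sz₂ cell) sE) refl -<+ $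
        then (ok sr₂ sp (spos x) (sz₂ cell) sE) refl $
        case m≤n⇒m<n∨m≡n (≤-pred i<r) of λ where
          (inj₁ i<m) →
            jumps (ok sr₂ sp (spos x) (sz₂+ cell) sE) refl (⊖-pos (s≤s i<m)) $
            continue (sz₂+ cell) (kept e (fixedRank i ai≡x i<m))
          (inj₂ i≡m) → case Fin.toℕ-injective i≡m of λ where
            refl →
              falls (ok sr₂ sp (spos x) (sz₂+ cell) sE) refl (ℤ.<-irrefl (sym (ℤ.n⊖n≡0 (val i)))) $
              stores (ok sr₂ sp (spos x) (sz₂+ cell) sE) x refl refl $
              continue (sz₂+ cell)
                (sweep-store swept (final i (subst (Block i) ai≡x (Block-a i)) ≤-refl))

    sweep₂ : ∀ {t D} → Small t → (∀ x → Cell₂ r x (lookup D x)) →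
             Reach (Head₂ (toℕ m)) (1 + (n * 8 + 2)) (st 36 (+ r) p (+ 0) t D)
    sweep₂ {t} {D} st′ cells =
      then (ok sr₂ sp z≤n st′ (lookup⁻ λ x → bound₂ (cells x))) refl $
      bind (loop Sweep₂ sweepBody₂ start) λ where
        (sweep st″ swept) →
          then (ok sr₂ sp z≤n st″ (entries₂ swept)) refl $
          repeats (ok (small {+ toℕ m} (<⇒≤ r≤n)) sp z≤n st″ (entries₂ swept)) (toℕ m) refl refl $
          now (head₂ sp z≤n st″ λ x → new swept x z≤n)
      where
      start : Sweep₂ n (st 37 (+ r) p (+ n) t D)
      start = subst (λ q → Sweep₂ n (st q (+ r) p (+ n) t D)) (target-head n≥1)
        (sweep st′ (mkSwept (λ x _ → cells x) λ x n≤x → contradiction (Fin.toℕ<n x) (≤⇒≯ n≤x)))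

    round₂ : ∀ {s} → Head₂ r s → Reach (Head₂ (toℕ m)) (24 * n) s
    round₂ (head₂ sc sy st′ cells) = weaken cost (bind (scan₂ cells sc sy st′) λ where
      (position st″) → sweep₂ st″ cells)
      where
      cost : 1 + (n * 6 + 0) + (1 + (n * 8 + 2)) ≤ 24 * n
      cost = ≤-trans (≤-reflexive (solve 1 (λ n →
          con 1 :+ (n :* con 6 :+ con 0) :+ (con 1 :+ (n :* con 8 :+ con 2)) :=
          con 4 :+ (n :* con 6 :+ n :* con 8)) refl n))
        (≤-trans (+-monoʳ-≤ 4 (+-monoʳ-≤ (n * 6) (*-monoʳ-≤ n (m≤m+n 8 3))))
          (round-cost 6 11 (m≤m+n 4 3) refl))
        where open +-*-Solver

  -- The r last rounds of the second phase.
  unrank₂ : ∀ r → r ≤ k → ∀ {s} → Head₂ r s → Reach (Head₂ 0) (r * (24 * n)) s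
  unrank₂ zero    _   h = now h
  unrank₂ (suc r) r<k h = bind
    (subst (λ j → ∀ {s} → Head₂ (suc j) s → Reach (Head₂ j) (24 * n) s) (Fin.toℕ-fromℕ< r<k)
      (round₂ (fromℕ< r<k)) h)
    (unrank₂ r (<⇒≤ r<k))

  -- The initial and the final array

  initialCell : ∀ x → Cell₁ 0 x (lookup signed x)
  initialCell x = subst (Cell₁ 0 x) (sym (lookup∘tabulate _ x)) cell
    where
    cell : Cell₁ 0 x (if φ x then ℤ.- (+ val (π x)) else + val (π x))
    cell with Fin.any? (λ i → a i Fin.≟ x)
    ... | yes (i , refl) = fixedTodo i refl z≤n
    ... | no x∉A = idleTodo (block x) (λ i e → x∉A (i , e)) (proj₂ (Block-exists x)) z≤n

  finalArray : ∀ {D} → (∀ x → Cell₂ 0 x (lookup D x)) → D ≡ mapArray ι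
  finalArray {D} cells = trans (sym (tabulate∘lookup D)) (tabulate-cong λ x → entry (cells x))
    where
    entry : ∀ {x z} → Cell₂ 0 x z → z ≡ + val (ι x)
    entry {x} (final i b _) = cong (+_ ∘ val) (sym (corresponding i x b))

  execution : ∀ {K s} → Reach (Head₂ 0) K s →
    Σ[ t ∈ ℕ ] Σ[ s′ ∈ State′ ] (Execution program 3 s t s′ × array s′ ≡ mapArray ι × t ≤ K)
  execution (now (head₂ sc sy st′ cells)) =
    0 , _ , halted (ok z≤n sc sy st′ (lookup⁻ λ x → bound₂ (cells x))) refl , finalArray cells , z≤n
  execution (then b e r) with t , s′ , ex , eq , t≤K ← execution r =
    suc t , s′ , next b e ex , eq , s≤s t≤K

  total-cost : suc k * (24 * n) + k * (24 * n) ≤ 72 * (k * n)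
  total-cost = begin
    suc k * (24 * n) + k * (24 * n)   ≤⟨ +-monoˡ-≤ (k * (24 * n)) (*-monoˡ-≤ (24 * n) (+-monoˡ-≤ k 1≤k)) ⟩
    (k + k) * (24 * n) + k * (24 * n) ≡⟨ solve 2 (λ k n →
      (k :+ k) :* (con 24 :* n) :+ k :* (con 24 :* n) := con 72 :* (k :* n)) refl k n ⟩
    72 * (k * n)                      ∎
    where
    open ≤-Reasoning
    open +-*-Solver

  correct : Σ[ t ∈ ℕ ] Σ[ s ∈ State′ ]
    (Execution program 3 (initial signed) t s × array s ≡ mapArray ι × t ≤ 72 * (k * n))
  correct = execution (weaken total-cost
    (bind (rank₁ k refl (head₁ z≤n z≤n z≤n initialCell)) (unrank₂ k ≤-refl)))

theorem3p13 : Σ[ P ∈ Program 4 ] Σ[ B ∈ ℕ ] Σ[ C ∈ ℕ ]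
    (∀ (n k : ℕ) (ip : IP n k) →
    Σ[ ι ∈ (Fin n → Fin n) ] (InI n k ι × IP.Corresponding ip ι ×
    (Σ[ t ∈ ℕ ] Σ[ s ∈ State 4 n ]
    (Execution P B (initial (IP.signed ip)) t s × array s ≡ mapArray ι × t ≤ C * (k * n)))))
theorem3p13 = program , 3 , 72 , λ n k ip →
  let open Algorithm ip in ι , ι-inI , corresponding , correct
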